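{- Let $q$ be a prime number, let $l\ge 2$ be an integer and let $N=q^{l}$. Then $$\mathbb{Q}\text{ - }\mathcal{KS}(N)=\Bigl(\bigcup_{s\in\mathbb{Z}\setminus\{0\}}\Bigl\{\,q+\frac{d}{s}\;:\; d \text{ a positive integer with } d\mid (q^{l}-q)\Bigr\}\Bigr)\setminus\{0,N\}.$$
   Context: Every nonzero rational $\alpha$ is written $\alpha=\alpha_1/\alpha_2$ with $\alpha_1\in\mathbb{Z}$, $\alpha_2$ a positive integer and $\gcd(\alpha_1,\alpha_2)=1$. For an integer $N\ge 2$ and a nonzero rational $\alpha=\alpha_1/\alpha_2$, $N$ is called an $\alpha$-Korselt number if $N\neq\alpha$ and $\alpha_2p-\alpha_1$ divides $\alpha_2N-\alpha_1$ (in $\mathbb{Z}$) for every prime divisor $p$ of $N$. For a subset $\mathbb{A}\subseteq\mathbb{Q}$, the Korselt set $\mathbb{A}\text{ - }\mathcal{KS}(N)$ is the set of all $\beta\in\mathbb{A}\setminus\{0,N\}$ such that $N$ is a $\beta$-Korselt number. Here $a\mid b$ means $b=ac$ for some integer $c$. -}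

module Defs where

open import Data.Integer.Base as ℤ using (ℤ; +_; 0ℤ)
open import Data.Integer.Divisibility.Signed using () renaming (_∣_ to _∣ℤ_)
open import Data.Nat.Base as ℕ using (ℕ)
import Data.Nat.Coprimality as Coprimality
open import Data.Nat.Divisibility using (_∣_)
open import Data.Nat.Primality using (Prime)
open import Data.Product.Base using (Σ-syntax; ∃-syntax; _×_; _,_)
open import Data.Rational.Base using (ℚ; mkℚ; ↥_; ↧_; 0ℚ; _+_; _÷_)
open import Level using (Level)
open import Relation.Binary.PropositionalEquality.Core using (_≡_; _≢_)
open import Relation.Unary using (Pred; _∩_; _∪_; _∖_; ｛_｝)

private variable
  ℓ : Level

-- With the bare constructor, ℤ.NonZero i and NonZero (fromℤ i) agree
-- definitionally, which is what lets _÷_ below find its instance.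
fromℤ : ℤ → ℚ
fromℤ i = mkℚ i 0 (Coprimality.sym (Coprimality.1-coprimeTo ℤ.∣ i ∣))

-- ℚ is stored in lowest terms with positive denominator, so α₁ = ↥ α
-- and α₂ = ↧ α.
record IsKorselt (N : ℕ) (α : ℚ) : Set where
  field
    2≤N     : 2 ℕ.≤ N
    α≢0     : α ≢ 0ℚ
    N≢α     : fromℤ (+ N) ≢ α
    divides : ∀ p → Prime p → p ∣ N →
              (↧ α ℤ.* + p ℤ.- ↥ α) ∣ℤ (↧ α ℤ.* + N ℤ.- ↥ α)

｛0,_｝ : ℕ → Pred ℚ _
｛0, N ｝ = ｛ 0ℚ ｝ ∪ ｛ fromℤ (+ N) ｝

infix 10 _-KS_

_-KS_ : Pred ℚ ℓ → ℕ → Pred ℚ ℓ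
A -KS N = (A ∖ ｛0, N ｝) ∩ IsKorselt N

ℤ∖0 : Set
ℤ∖0 = Σ[ s ∈ ℤ ] s ≢ 0ℤ

-- { q + d / s : d a positive integer dividing m }
shiftedQuotients : (q : ℕ) (m : ℤ) → ℤ∖0 → Pred ℚ _
shiftedQuotients q m (s , s≢0) β =
  ∃[ d ] 1 ℕ.≤ d × (+ d) ∣ℤ m × β ≡ fromℤ (+ q) + (fromℤ (+ d) ÷ fromℤ s)
  where instance _ = ℤ.≢-nonZero s≢0

{-# OPTIONS --safe #-}

-- Write β = a / b in lowest terms and t = b q - a, so that β = q - t / b.
-- Since b qˡ - a = b (qˡ - q) + t and t is coprime to b, the Korselt condition
-- at q, which is the only prime factor of qˡ, says that t divides qˡ - q.
-- One inclusion takes d = |t|; for the other, q + d / s = q - t / b gives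
-- t s = - d b, whence t divides d by coprimality.

module Submission where

open import Defs
open import Data.Integer.Base using (+_; _-_)
open import Data.Nat.Base using (ℕ; _≤_; _^_)
open import Data.Nat.Primality using (Prime)
open import Relation.Unary using (U; ⋃; _≐_; _∖_)

open import Data.Integer.Base as ℤ using (ℤ; -[1+_]; +[1+_]; +0; 0ℤ; 1ℤ)
import Data.Integer.Coprimality as ℤ
open import Data.Integer.Divisibility.Signed as ℤ using () renaming (_∣_ to _∣ℤ_)
import Data.Integer.Properties as ℤ
open import Data.Integer.Tactic.RingSolver using (solve-∀)
import Data.Nat.Base as ℕ
import Data.Nat.Coprimality as ℕ
import Data.Nat.Divisibility as ℕ
import Data.Nat.Properties as ℕ
open import Data.Nat.Primality
  using (euclidsLemma; prime⇒irreducible; prime⇒nonTrivial)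
open import Data.Product.Base using (∃-syntax; _×_; _,_)
open import Data.Rational.Base as ℚ using (ℚ; mkℚ; ↥_; ↧_; toℚᵘ)
import Data.Rational.Properties as ℚ
open import Data.Rational.Unnormalised.Base as ℚᵘ using (*≡*)
import Data.Rational.Unnormalised.Properties as ℚᵘ
open import Data.Sum.Base using (inj₁; inj₂)
open import Function.Base using (_∘_)
open import Relation.Binary.PropositionalEquality
  using (_≡_; _≢_; refl; sym; trans; cong; subst; module ≡-Reasoning)
open import Relation.Nullary.Negation using (contradiction)

m∣m^n : ∀ m {n} → 1 ≤ n → m ℕ.∣ m ^ n
m∣m^n m {ℕ.suc n} _ = ℕ.m∣m*n (m ^ n)

prime∣prime⇒≡ : ∀ {p q} → Prime p → Prime q → p ℕ.∣ q → p ≡ q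
prime∣prime⇒≡ pp pq p∣q with prime⇒irreducible pq p∣q
... | inj₁ refl = contradiction (ℕ.nonTrivial⇒n>1 1 {{prime⇒nonTrivial pp}}) ℕ.1+n≰n
... | inj₂ p≡q  = p≡q

prime∣prime^⇒≡ : ∀ {p q} n → Prime p → Prime q → p ℕ.∣ q ^ n → p ≡ q
-- Here `p` would divide 1. Since 1 divides `q`, so would `p`, and the case of a prime dividing a
-- prime closes this one too.
prime∣prime^⇒≡ ℕ.zero pp pq p∣1 =
  prime∣prime⇒≡ pp pq (ℕ.∣-trans p∣1 (ℕ.1∣ _))
prime∣prime^⇒≡ {q = q} (ℕ.suc n) pp pq p∣qⁿ⁺¹ with euclidsLemma q (q ^ n) pp p∣qⁿ⁺¹
... | inj₁ p∣q  = prime∣prime⇒≡ pp pq p∣q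
... | inj₂ p∣qⁿ = prime∣prime^⇒≡ n pp pq p∣qⁿ

coprime-divisor : ∀ i j k → ℤ.Coprime i j → i ∣ℤ j ℤ.* k → i ∣ℤ k
coprime-divisor i j k c = ℤ.∣ᵤ⇒∣ ∘ ℤ.coprime-divisor i j k c ∘ ℤ.∣⇒∣ᵤ

-- Both sides of the Korselt divisibility have this form; the t of the overview is `shift β (+ q)`.
shift : ℚ → ℤ → ℤ
shift β n = ↧ β ℤ.* n ℤ.- ↥ β

-- A common divisor of b n - a and b also divides a, and a / b is in lowest terms.
shift-coprime : ∀ β n → ℤ.Coprime (shift β n) (↧ β)
-- The coprimality proof stored in a rational is irrelevant; `ℕ.recompute` turns it into a usable
-- one.
shift-coprime β@(mkℚ a _ c) n {k} (k∣t , k∣b) = ℕ.recompute c (k∣a , k∣b)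
  where
  cancel : ∀ x y → x ℤ.- (x ℤ.- y) ≡ y
  cancel = solve-∀
  k∣a : k ℕ.∣ ℤ.∣ a ∣
  k∣a = ℤ.∣⇒∣ᵤ (subst (+ k ∣ℤ_) (cancel (↧ β ℤ.* n) a)
    (ℤ.∣m∣n⇒∣m-n (ℤ.∣m⇒∣m*n n (ℤ.∣ᵤ⇒∣ {+ k} {↧ β} k∣b)) (ℤ.∣ᵤ⇒∣ {+ k} k∣t)))

shift-decompose : ∀ β m n → shift β m ≡ ↧ β ℤ.* (m ℤ.- n) ℤ.+ shift β n
shift-decompose β m n = identity (↧ β) (↥ β) m n
  where
  identity : ∀ b a m n → b ℤ.* m ℤ.- a ≡ b ℤ.* (m ℤ.- n) ℤ.+ (b ℤ.* n ℤ.- a)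
  identity = solve-∀

-- Removing the summand `shift β n` from the decomposition leaves a multiple of `↧ β`, and that
-- factor is cancelled by coprimality.
shift∣shift⇒shift∣- : ∀ β m n → shift β n ∣ℤ shift β m → shift β n ∣ℤ m ℤ.- n
shift∣shift⇒shift∣- β m n t∣ = coprime-divisor (shift β n) (↧ β) (m ℤ.- n) (shift-coprime β n)
  (ℤ.∣m+n∣n⇒∣m (subst (shift β n ∣ℤ_) (shift-decompose β m n) t∣) ℤ.∣-refl)

shift∣-⇒shift∣shift : ∀ β m n → shift β n ∣ℤ m ℤ.- n → shift β n ∣ℤ shift β m
shift∣-⇒shift∣shift β m n t∣ = subst (shift β n ∣ℤ_) (sym (shift-decompose β m n))
  (ℤ.∣m∣n⇒∣m+n (ℤ.∣n⇒∣m*n (↧ β) t∣) ℤ.∣-refl)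

-- The factors 1ℤ below are those that cross-multiplication in ℚᵘ leaves behind.
module _ (n d s : ℤ) {{_ : ℤ.NonZero s}} where

  private
    N = fromℤ n
    D = fromℤ d
    S = fromℤ s

    -- On the right nothing is reduced by a gcd, so numerator and denominator are explicit
    -- polynomials in `n`, `s` and `d`.
    rhs≃ : toℚᵘ (N ℚ.* S ℚ.+ D) ℚᵘ.≃ toℚᵘ N ℚᵘ.* toℚᵘ S ℚᵘ.+ toℚᵘ D
    rhs≃ = ℚᵘ.≃-trans (ℚ.toℚᵘ-homo-+ (N ℚ.* S) D)
      (ℚᵘ.+-congˡ (toℚᵘ D) (ℚ.toℚᵘ-homo-* N S))

    ÷-* : ∀ x → (x ℚ.÷ S) ℚ.* S ≡ x
    ÷-* x = trans (ℚ.*-assoc x (ℚ.1/ S) S)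
      (trans (cong (x ℚ.*_) (ℚ.*-inverseˡ S)) (ℚ.*-identityʳ x))

    *-÷ : ∀ x → (x ℚ.* S) ℚ.÷ S ≡ x
    *-÷ x = trans (ℚ.*-assoc x S (ℚ.1/ S))
      (trans (cong (x ℚ.*_) (ℚ.*-inverseʳ S)) (ℚ.*-identityʳ x))

  -- Multiplying by `S` removes the division; cross-multiplying in `ℚᵘ` then gives an integer
  -- equation, which ring identities rearrange.
  ≡+÷⇒shift*≡ : ∀ β → β ≡ N ℚ.+ D ℚ.÷ S → shift β n ℤ.* s ≡ ℤ.- (d ℤ.* ↧ β)
  -- Matching on `record{}` exposes the constructor, so that `toℚᵘ β` computes.
  ≡+÷⇒shift*≡ β@record{} β≡ with ℚᵘ.≃-trans (ℚᵘ.≃-sym (ℚ.toℚᵘ-homo-* β S)) (ℚᵘ.≃-trans (ℚ.toℚᵘ-cong β*S≡) rhs≃)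
    where
    β*S≡ : β ℚ.* S ≡ N ℚ.* S ℚ.+ D
    β*S≡ = trans (cong (ℚ._* S) β≡)
      (trans (ℚ.*-distribʳ-+ S N (D ℚ.÷ S)) (cong (N ℚ.* S ℚ.+_) (÷-* D)))
  ... | *≡* eq = begin
    (b ℤ.* n ℤ.- a) ℤ.* s                                             ≡⟨ expand a b n s ⟩
    b ℤ.* n ℤ.* s ℤ.- a ℤ.* s ℤ.* 1ℤ                                  ≡⟨ cong (λ x → b ℤ.* n ℤ.* s ℤ.- x) eq ⟩
    b ℤ.* n ℤ.* s ℤ.- (n ℤ.* s ℤ.* 1ℤ ℤ.+ d ℤ.* 1ℤ) ℤ.* (b ℤ.* 1ℤ)  ≡⟨ collapse b n s d ⟩
    ℤ.- (d ℤ.* b)                                                     ∎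
    where
    open ≡-Reasoning
    b = ↧ β
    a = ↥ β
    expand : ∀ a b n s → (b ℤ.* n ℤ.- a) ℤ.* s ≡ b ℤ.* n ℤ.* s ℤ.- a ℤ.* s ℤ.* 1ℤ
    expand = solve-∀
    collapse : ∀ b n s d →
      b ℤ.* n ℤ.* s ℤ.- (n ℤ.* s ℤ.* 1ℤ ℤ.+ d ℤ.* 1ℤ) ℤ.* (b ℤ.* 1ℤ) ≡ ℤ.- (d ℤ.* b)
    collapse = solve-∀

  shift*≡⇒≡+÷ : ∀ β → shift β n ℤ.* s ≡ ℤ.- (d ℤ.* ↧ β) → β ≡ N ℚ.+ D ℚ.÷ S
  shift*≡⇒≡+÷ β@record{} t*s≡ = begin
    β                                  ≡⟨ *-÷ β ⟨
    (β ℚ.* S) ℚ.÷ S                    ≡⟨ cong (ℚ._÷ S) β*S≡ ⟩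
    (N ℚ.* S ℚ.+ D) ℚ.÷ S              ≡⟨ ℚ.*-distribʳ-+ (ℚ.1/ S) (N ℚ.* S) D ⟩
    (N ℚ.* S) ℚ.÷ S ℚ.+ D ℚ.÷ S        ≡⟨ cong (ℚ._+ D ℚ.÷ S) (*-÷ N) ⟩
    N ℚ.+ D ℚ.÷ S                      ∎
    where
    open ≡-Reasoning
    b = ↧ β
    a = ↥ β
    expand : ∀ a b n s → a ℤ.* s ℤ.* 1ℤ ≡ b ℤ.* n ℤ.* s ℤ.- (b ℤ.* n ℤ.- a) ℤ.* s
    expand = solve-∀
    collapse : ∀ b n s d →
      b ℤ.* n ℤ.* s ℤ.- ℤ.- (d ℤ.* b) ≡ (n ℤ.* s ℤ.* 1ℤ ℤ.+ d ℤ.* 1ℤ) ℤ.* (b ℤ.* 1ℤ)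
    collapse = solve-∀
    cross : a ℤ.* s ℤ.* 1ℤ ≡ (n ℤ.* s ℤ.* 1ℤ ℤ.+ d ℤ.* 1ℤ) ℤ.* (b ℤ.* 1ℤ)
    cross = trans (expand a b n s)
      (trans (cong (λ x → b ℤ.* n ℤ.* s ℤ.- x) t*s≡) (collapse b n s d))
    β*S≡ : β ℚ.* S ≡ N ℚ.* S ℚ.+ D
    β*S≡ = ℚ.toℚᵘ-injective (ℚᵘ.≃-trans (ℚ.toℚᵘ-homo-* β S) (ℚᵘ.≃-trans (*≡* cross) (ℚᵘ.≃-sym rhs≃)))

-- As `d` = |t| is positive, the sign of t must go into `s`: it is `- b` for positive t and `b` for
-- negative t.
∃-signed-multiple : ∀ t b → t ≢ 0ℤ → b ≢ 0ℤ →
  ∃[ s ] s ≢ 0ℤ × t ℤ.* s ≡ ℤ.- (+ ℤ.∣ t ∣ ℤ.* b)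
∃-signed-multiple +0           b t≢0 b≢0 = contradiction refl t≢0
∃-signed-multiple t@(+[1+ _ ]) b t≢0 b≢0 =
  ℤ.- b , b≢0 ∘ ℤ.neg-injective , sym (ℤ.neg-distribʳ-* t b)
∃-signed-multiple t@(-[1+ k ]) b t≢0 b≢0 =
  b , b≢0 , sym (ℤ.neg-distribˡ-* (+[1+ k ]) b)

shift∣⇒shiftedQuotient : ∀ q m β → shift β (+ q) ≢ 0ℤ → shift β (+ q) ∣ℤ m →
  ⋃ ℤ∖0 (shiftedQuotients q m) β
shift∣⇒shiftedQuotient q m β t≢0 t∣m
  with s , s≢0 , t*s≡ ← ∃-signed-multiple (shift β (+ q)) (↧ β) t≢0 (λ ())
  = (s , s≢0) , ℤ.∣ t ∣ , ℕ.n≢0⇒n>0 (t≢0 ∘ ℤ.∣i∣≡0⇒i≡0) , ℤ.∣-trans ℤ.∣m∣∣m t∣m ,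
    shift*≡⇒≡+÷ (+ q) (+ ℤ.∣ t ∣) s {{ℤ.≢-nonZero s≢0}} β t*s≡
  where t = shift β (+ q)

-- The given `d` may be any multiple of |t| dividing `m`, so t ∣ d is recovered first and
-- transitivity does the rest.
shiftedQuotient⇒shift∣ : ∀ q m β → ⋃ ℤ∖0 (shiftedQuotients q m) β → shift β (+ q) ∣ℤ m
shiftedQuotient⇒shift∣ q m β ((s , s≢0) , d , _ , d∣m , β≡) = ℤ.∣-trans t∣d d∣m
  where
  t = shift β (+ q)
  b*d≡ : ↧ β ℤ.* + d ≡ ℤ.- (t ℤ.* s)
  b*d≡ = trans (ℤ.*-comm (↧ β) (+ d)) (trans (sym (ℤ.neg-involutive _))
    (cong ℤ.-_ (sym (≡+÷⇒shift*≡ (+ q) (+ d) s {{ℤ.≢-nonZero s≢0}} β β≡))))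
  t∣d : t ∣ℤ + d
  t∣d = coprime-divisor t (↧ β) (+ d) (shift-coprime β (+ q))
    (subst (t ∣ℤ_) (sym b*d≡) (ℤ.∣m⇒∣-m (ℤ.∣m⇒∣m*n s ℤ.∣-refl)))

theorem3p1 : (q l : ℕ) → Prime q → 2 ≤ l →
    U -KS (q ^ l) ≐ (⋃ ℤ∖0 (shiftedQuotients q (+ (q ^ l) - + q))) ∖ ｛0, q ^ l ｝
theorem3p1 q l pq 2≤l = korselt⇒quotient , quotient⇒korselt
  where
  m = + (q ^ l) - + q

  1<q : 1 ℕ.< q
  1<q = ℕ.nonTrivial⇒n>1 q {{prime⇒nonTrivial pq}}

  q<qˡ : q ℕ.< q ^ l
  q<qˡ = subst (ℕ._< q ^ l) (ℕ.^-identityʳ q) (ℕ.^-monoʳ-< q 1<q 2≤l)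

  q∣qˡ : q ℕ.∣ q ^ l
  q∣qˡ = m∣m^n q (ℕ.<⇒≤ 2≤l)

  m≢0 : m ≢ 0ℤ
  m≢0 = ℕ.>⇒≢ q<qˡ ∘ ℤ.+-injective ∘ ℤ.i-j≡0⇒i≡j (+ (q ^ l)) (+ q)

  korselt⇒quotient : ∀ {β} → (U -KS (q ^ l)) β →
    ((⋃ ℤ∖0 (shiftedQuotients q m)) ∖ ｛0, q ^ l ｝) β
  korselt⇒quotient {β} ((_ , β∉) , korselt) = shift∣⇒shiftedQuotient q m β t≢0 t∣m , β∉
    where
    t∣m : shift β (+ q) ∣ℤ m
    t∣m = shift∣shift⇒shift∣- β (+ (q ^ l)) (+ q) (IsKorselt.divides korselt q pq q∣qˡ)
    -- This excludes β = q, where |t| would not be a positive `d`: 0 cannot divide q^l - q, which is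
    -- nonzero because l is at least 2.
    t≢0 : shift β (+ q) ≢ 0ℤ
    t≢0 t≡0 = m≢0 (ℤ.0∣⇒≡0 (subst (_∣ℤ m) t≡0 t∣m))

  quotient⇒korselt : ∀ {β} → ((⋃ ℤ∖0 (shiftedQuotients q m)) ∖ ｛0, q ^ l ｝) β →
    (U -KS (q ^ l)) β
  quotient⇒korselt {β} (β∈ , β∉) = (_ , β∉) , record
    { 2≤N     = ℕ.<⇒≤ (ℕ.≤-<-trans 1<q q<qˡ)
    ; α≢0     = β∉ ∘ inj₁ ∘ sym
    ; N≢α     = β∉ ∘ inj₂
    ; divides = λ p pp p∣qˡ → subst (λ r → shift β (+ r) ∣ℤ shift β (+ (q ^ l)))
        (sym (prime∣prime^⇒≡ l pp pq p∣qˡ))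
        (shift∣-⇒shift∣shift β (+ (q ^ l)) (+ q) (shiftedQuotient⇒shift∣ q m β β∈))
    }
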